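{- There is an absolute constant $c>1/2$ such that for every prime $p$ and every positive integer $n$ that is sufficiently large in terms of $p$, we have $r_3(\mathbb{F}_p^n)\ge (cp)^n$.
   Context: For a finite abelian group $G$, $r_3(G)$ denotes the maximum possible size of a subset $A\subseteq G$ such that there do not exist distinct $x,y,z\in A$ with $x+z=y+y$. Here $\mathbb{F}_p^n$ is viewed as an abelian group under addition. -}

module Defs where

open import Data.Nat using (ℕ)
open import Data.Fin using (Fin; toℕ)
open import Data.Vec using (Vec; lookup)
open import Data.List using (List)
open import Data.List.Membership.Propositional using (_∈_)
open import Data.Integer using (ℤ; +_; _-_; _+_; _*_)
open import Data.Integer.Divisibility using (_∣_)
open import Relation.Binary.PropositionalEquality using (_≢_)
open import Relation.Nullary using (¬_)

𝔽^ : ℕ → ℕ → Set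
𝔽^ p n = Vec (Fin p) n

IsAP : (p n : ℕ) → 𝔽^ p n → 𝔽^ p n → 𝔽^ p n → Set
IsAP p n x y z = ∀ (i : Fin n) →
  (+ p) ∣ ((+ toℕ (lookup x i) + + toℕ (lookup z i))
           - (+ toℕ (lookup y i) + + toℕ (lookup y i)))

ThreeAPFree : (p n : ℕ) → List (𝔽^ p n) → Set
ThreeAPFree p n A = ∀ x y z → x ∈ A → y ∈ A → z ∈ A →
  x ≢ y → y ≢ z → x ≢ z → ¬ IsAP p n x y z

{-# OPTIONS --safe #-}

-- For odd p = 2m + 1 we use a dense S ⊆ F_p² with a weight f such that f x + f z > 2 f y for
-- every nontrivial progression x, y, z in S.  Then the words in S^k of any fixed total weight
-- contain no progression, and by pigeonhole one weight class has size at least |S|^k / O(k).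
-- The square {0, …, m}² (with f a sum of two squares) has density just above 1/4, which would
-- only give the constant 1/2.  Cutting a triangle off the square makes room, in the columns
-- a = m + 1 + s, for intervals which in total gain twice as much as is lost: the progressions
-- whose first coordinate wraps around have their middle term in the new columns and their end
-- terms in columns a₁ + a₃ = 2s + 1, and the values missing from these two columns are what
-- the new column contains.  With M ≈ p / 4 new columns, |S| ≥ 9p² / 32.  As √(9/32) > 11/21 > 1/2,
-- the exponential gain absorbs the loss from the pigeonhole principle.  For p = 2 there are no
-- progressions of distinct points at all.
module Submission where

open import Defs
open import Data.Nat using (ℕ; _≤_; _<_; _*_; _^_)
open import Data.Nat.Primality using (Prime)
open import Data.Product using (Σ; ∃; _×_)
open import Data.List using (List; length)
open import Data.List.Relation.Unary.Unique.Propositional using (Unique)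

import Algebra.Properties.CommutativeSemigroup as CommutativeSemigroupProperties
open import Data.Bool using (true; false)
open import Data.Fin using (Fin; zero; suc; toℕ; fromℕ<)
open import Data.Fin.Properties using (toℕ<n; toℕ≤pred[n]; toℕ-injective; toℕ-fromℕ<; fromℕ<-injective; all?) renaming (_≟_ to _≟ᶠ_)
import Data.Integer as ℤ
import Data.Integer.Properties as ℤₚ
open import Data.List using ([]; _∷_; filter; concat; tabulate; _++_; cartesianProductWith; map; allFin)
open import Data.List.Membership.Propositional using (_∈_)
open import Data.List.Membership.Propositional.Properties
  using (∈-cartesianProductWith⁻; ∈-concat⁻′; ∈-tabulate⁻; ∈-++⁻; ∈-filter⁻)
open import Data.List.Properties using (length-++; length-tabulate; length-map)
open import Data.List.Relation.Binary.Sublist.Propositional.Properties using (filter-⊆; filter⁺; length-mono-≤)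
open import Data.List.Relation.Unary.All using ([])
import Data.List.Relation.Unary.All.Properties as Allₚ
open import Data.List.Relation.Unary.AllPairs using ([]; _∷_)
import Data.List.Relation.Unary.AllPairs.Properties as AllPairsₚ
open import Data.List.Relation.Unary.Any using (here)
import Data.List.Relation.Unary.Unique.Propositional.Properties as Uniqueₚ
open import Data.Nat using (zero; suc; _+_; _∸_; z≤n; s≤s; ∣_-_∣; _≟_; NonZero; _%_; _/_)
open import Data.Nat.Coprimality using (Coprime; coprime-divisor)
open import Data.Nat.DivMod using (m≡m%n+[m/n]*n; m%n<n)
open import Data.Nat.Divisibility using (_∣_; _∣?_; divides; ∣⇒≤; ∣m+n∣m⇒∣n; ∣m∣n⇒∣m+n; ∣1⇒≡1; ∣n⇒∣m*n)
open import Data.Nat.ListAction using (sum)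
open import Data.Nat.Primality using (prime⇒irreducible)
open import Data.Nat.Properties hiding (_≟_)
open import Data.Nat.Tactic.RingSolver using (solve-∀)
open import Data.Product using (_,_; proj₁; proj₂)
open import Data.Product.Properties using (,-injective)
open import Data.Sum using (_⊎_; inj₁; inj₂)
open import Data.Vec using ([]; _∷_; lookup)
open import Function using (_∘_; id)
open import Level using (0ℓ)
open import Relation.Binary using (tri<; tri≈; tri>)
open import Relation.Binary.PropositionalEquality
open import Relation.Nullary using (¬_; contradiction; does; _→-dec_)
open import Relation.Nullary.Decidable using (from-yes)
open import Relation.Unary using (Pred; Decidable)
open import Relation.Unary.Properties using (∁?)

open CommutativeSemigroupProperties +-commutativeSemigroup using () renaming (interchange to +-interchange)
open CommutativeSemigroupProperties *-commutativeSemigroup using ()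
  renaming (interchange to *-interchange; x∙yz≈y∙xz to *-swapˡ)

-- Convexity of squares, and congruences modulo an odd number.

square-strict : ∀ u v y → u < y → y + y ≤ u + v → y * y + y * y < u * u + v * v
square-strict u v y u<y 2y≤u+v with m≤n⇒∃[o]m+o≡n u<y
-- `suc d` is the distance from `u` up to `y`, and `v` lies at least as far above `y`.
... | d , refl = begin-strict
  y * y + y * y                         ≡⟨ sym (+-identityʳ _) ⟩
  y * y + y * y + 0                     <⟨ +-monoʳ-< (y * y + y * y) (s≤s z≤n) ⟩
  y * y + y * y + (suc d * suc d + suc d * suc d) ≡⟨ identity u d ⟩
  u * u + (y + suc d) * (y + suc d)     ≤⟨ +-monoʳ-≤ (u * u) (*-mono-≤ y+e≤v y+e≤v) ⟩
  u * u + v * v                         ∎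
  where
  open ≤-Reasoning
  shift : ∀ u d → (suc u + d) + (suc u + d) ≡ u + ((suc u + d) + suc d)
  shift = solve-∀
  y+e≤v : y + suc d ≤ v
  y+e≤v = +-cancelˡ-≤ u _ _ (subst (_≤ u + v) (shift u d) 2y≤u+v)
  identity : ∀ u d → (suc u + d) * (suc u + d) + (suc u + d) * (suc u + d) + (suc d * suc d + suc d * suc d)
    ≡ u * u + ((suc u + d) + suc d) * ((suc u + d) + suc d)
  identity = solve-∀

-- If an end lies below `y`, `square-strict` applies; otherwise squares are monotone. Assuming only
-- `≤` also covers sums `u + v` that exceed `y + y` by a multiple of the modulus.
square-convex : ∀ u v y → y + y ≤ u + v →
  (y * y + y * y < u * u + v * v) ⊎ (u ≡ y × y ≡ v)
square-convex u v y 2y≤u+v with <-cmp u y | <-cmp v y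
... | tri< u<y _ _ | _ = inj₁ (square-strict u v y u<y 2y≤u+v)
... | tri≈ _ _ _ | tri< v<y _ _ =
  inj₁ (subst (y * y + y * y <_) (+-comm (v * v) (u * u))
    (square-strict v u y v<y (subst (y + y ≤_) (+-comm u v) 2y≤u+v)))
... | tri> _ _ _ | tri< v<y _ _ =
  inj₁ (subst (y * y + y * y <_) (+-comm (v * v) (u * u))
    (square-strict v u y v<y (subst (y + y ≤_) (+-comm u v) 2y≤u+v)))
... | tri≈ _ refl _ | tri≈ _ refl _ = inj₂ (refl , refl)
... | tri≈ _ refl _ | tri> _ _ y<v = inj₁ (+-monoʳ-< (y * y) (*-mono-< y<v y<v))
... | tri> _ _ y<u | tri≈ _ refl _ = inj₁ (+-monoˡ-< (y * y) (*-mono-< y<u y<u))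
... | tri> _ _ y<u | tri> _ _ y<v = inj₁ (+-mono-< (*-mono-< y<u y<u) (*-mono-< y<v y<v))

congruent-gap : ∀ {p x y} → p ∣ ∣ x - y ∣ → x < y → x + p ≤ y
congruent-gap {p} {x} {y} p∣ x<y with m≤n⇒∃[o]m+o≡n (<⇒≤ x<y)
... | zero , refl = contradiction x<y (<-irrefl (sym (+-identityʳ x)))
... | suc d , refl = +-monoʳ-≤ x (∣⇒≤ (subst (p ∣_) (∣m-m+n∣≡n x (suc d)) p∣))

congruent-unique : ∀ {p x y} → p ∣ ∣ x - y ∣ → x < y + p → y < x + p → x ≡ y
congruent-unique {p} {x} {y} p∣ x<y+p y<x+p with <-cmp x y
... | tri≈ _ x≡y _ = x≡y
... | tri< x<y _ _ = contradiction y<x+p (≤⇒≯ (congruent-gap p∣ x<y))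
... | tri> _ _ y<x = contradiction x<y+p
      (≤⇒≯ (congruent-gap (subst (p ∣_) (∣-∣-comm x y) p∣) y<x))

-- The modulus is odd, so 2 is invertible. This undoes the doubling of second coordinates in the
-- lower part.
congruent-halve : ∀ m x y → suc (m + m) ∣ ∣ x + x - y + y ∣ → suc (m + m) ∣ ∣ x - y ∣
congruent-halve m x y p∣ = coprime-divisor odd (subst (suc (m + m) ∣_) double p∣)
  where
  odd : Coprime (suc (m + m)) 2
  odd {d} (d∣p , d∣2) = ∣1⇒≡1 (∣m+n∣m⇒∣n (subst (d ∣_) (reorder m) d∣p) (∣n⇒∣m*n m d∣2))
    where
    reorder : ∀ m → suc (m + m) ≡ m * 2 + 1
    reorder = solve-∀
  twice : ∀ n → n + n ≡ 2 * n
  twice = solve-∀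
  double : ∣ x + x - y + y ∣ ≡ 2 * ∣ x - y ∣
  double = trans (cong₂ ∣_-_∣ (twice x) (twice y)) (sym (*-distribˡ-∣-∣ 2 x y))

-- The region in the plane and its weight.

module Region (m M : ℕ) (2M≤1+m : M + M ≤ suc m) where

  p : ℕ
  p = suc (m + m)

  -- In the lower part the second coordinate of the cut square is doubled, a dilation of F_p under
  -- which the part of S in a new column becomes an interval ending at p - 1.
  data InS : ℕ → ℕ → Set where
    lower : ∀ {a b} → a ≤ m → b ≤ m → b + M ≤ m + a → InS a (b + b)
    upper : ∀ {a c} → m < a → a ≤ m + M → c < p → a + a ≤ c + (M + M) → InS a c

  -- Large enough for the first coordinate to dominate the second in f.
  K : ℕ
  K = 2 * (p * p)

  f : ℕ → ℕ → ℕ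
  f a c = K * (a * a) + c * c

  M≤m : M ≤ m
  M≤m = half M 2M≤1+m
    where
    half : ∀ M → M + M ≤ suc m → M ≤ m
    half zero    _ = z≤n
    half (suc M) (s≤s q) = ≤-trans (m≤n+m (suc M) M) q

  fst<p : ∀ {a c} → InS a c → a < p
  fst<p (lower a≤m _ _)     = s≤s (≤-trans a≤m (m≤m+n m m))
  fst<p (upper _ a≤m+M _ _) = s≤s (≤-trans a≤m+M (+-monoʳ-≤ m M≤m))

  snd<p : ∀ {a c} → InS a c → c < p
  snd<p (lower _ b≤m _)   = s≤s (+-mono-≤ b≤m b≤m)
  snd<p (upper _ _ c<p _) = c<p

  -- The bound on `M` confines each new column to values from `m + 1` to `m + m`, too short a range
  -- for two sums of two values to differ by `p`.
  upper⇒m<c : ∀ {a} c → m < a → a + a ≤ c + (M + M) → m < c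
  upper⇒m<c {a} c m<a h = +-cancelʳ-≤ (suc m) (suc m) c (begin
    suc m + suc m  ≤⟨ +-mono-≤ m<a m<a ⟩
    a + a          ≤⟨ h ⟩
    c + (M + M)    ≤⟨ +-monoʳ-≤ c 2M≤1+m ⟩
    c + suc m      ∎)
    where open ≤-Reasoning

  upper-span : ∀ {x y z w} → m < x → m < y → z < p → w < p → z + w < x + y + p
  upper-span {x} {y} {z} {w} m<x m<y z<p w<p = begin-strict
    z + w                   <⟨ +-mono-< z<p w<p ⟩
    p + p                   ≤⟨ +-monoˡ-≤ p (s≤s (+-monoʳ-≤ m (n≤1+n m))) ⟩
    suc m + suc m + p       ≤⟨ +-monoˡ-≤ p (+-mono-≤ m<x m<y) ⟩
    x + y + p               ∎
    where open ≤-Reasoning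

  lower-span : ∀ {x y z w} → z ≤ m → w ≤ m → z + w < x + y + p
  lower-span {x} {y} z≤m w≤m = ≤-trans (s≤s (+-mono-≤ z≤m w≤m)) (m≤n+m p (x + y))

  halves : ∀ x z → (x + x) + (z + z) ≡ (x + z) + (x + z)
  halves = solve-∀

  -- Once the first coordinates agree, the second ones must decide without wrapping. A column is,
  -- after halving in the lower part, contained in an interval of at most `m + 1` values, so
  -- congruent sums of two are equal.
  fibre-rigid : ∀ {a c₁ c₂ c₃} → InS a c₁ → InS a c₂ → InS a c₃ →
    p ∣ ∣ c₁ + c₃ - c₂ + c₂ ∣ → c₁ + c₃ ≡ c₂ + c₂
  fibre-rigid {_} {c₁} {c₂} {c₃} (upper l _ u₁ h₁) (upper _ _ u₂ h₂) (upper _ _ u₃ h₃) p∣ =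
    congruent-unique p∣ (upper-span m<c₂ m<c₂ u₁ u₃)
      (upper-span (upper⇒m<c c₁ l h₁) (upper⇒m<c c₃ l h₃) u₂ u₂)
    where m<c₂ = upper⇒m<c c₂ l h₂
  fibre-rigid (lower {b = b₁} _ u₁ _) (lower {b = b₂} _ u₂ _) (lower {b = b₃} _ u₃ _) p∣ =
    trans (halves b₁ b₃) (cong (λ n → n + n)
      (congruent-unique (congruent-halve m (b₁ + b₃) (b₂ + b₂) (subst (λ n → p ∣ ∣ n - (b₂ + b₂) + (b₂ + b₂) ∣) (halves b₁ b₃) p∣))
        (lower-span {b₂} u₁ u₃) (lower-span {b₁} u₂ u₂)))
  fibre-rigid (lower a≤m _ _) (upper m<a _ _ _) _ _ = contradiction m<a (≤⇒≯ a≤m)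
  fibre-rigid (upper m<a _ _ _) (lower a≤m _ _) _ _ = contradiction m<a (≤⇒≯ a≤m)
  fibre-rigid (lower a≤m _ _) _ (upper m<a _ _ _) _ = contradiction m<a (≤⇒≯ a≤m)
  fibre-rigid (upper m<a _ _ _) _ (lower a≤m _ _) _ = contradiction m<a (≤⇒≯ a≤m)

  lower-if-small : ∀ {a c} → InS a c → a ≤ m → ∃ λ b → c ≡ b + b × b + M ≤ m + a
  lower-if-small (lower {b = b} _ _ h) _ = b , refl , h
  lower-if-small (upper m<a _ _ _) a≤m = contradiction m<a (≤⇒≯ a≤m)

  -- This is the one kind of wraparound that could defeat convexity. A middle term in the lower part
  -- is too small for it. For a middle term in a new column, the cut makes `b₁ + b₃` smaller than
  -- `c₂`, and being congruent to `c₂` it would force `c₂` beyond `p`.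
  no-wrap : ∀ {a₁ c₁ a₂ c₂ a₃ c₃} → InS a₁ c₁ → InS a₂ c₂ → InS a₃ c₃ →
    p ∣ ∣ c₁ + c₃ - c₂ + c₂ ∣ → ¬ (a₁ + a₃ + p ≤ a₂ + a₂)
  no-wrap {a₁} {_} {a₂} {_} {a₃} _ (lower a₂≤m _ _) _ _ h =
    <⇒≱ (s≤s (+-mono-≤ a₂≤m a₂≤m)) (≤-trans (m≤n+m p (a₁ + a₃)) h)
  no-wrap {a₁} {_} {a₂} {c₂} {a₃} x (upper m<a₂ a₂≤m+M c₂<p 2a₂≤c₂+2M) z p∣ h
    with lower-if-small x (≤-trans (m≤m+n a₁ a₃) a₁+a₃≤m) | lower-if-small z (≤-trans (m≤n+m a₃ a₁) a₁+a₃≤m)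
    where
    open ≤-Reasoning
    collect : ∀ m M → m + M + (m + M) ≡ M + M + (m + m)
    collect = solve-∀
    a₁+a₃≤m : a₁ + a₃ ≤ m
    -- Twice the last new column minus `p` is at most `m`, so both end terms lie in the lower part.
    a₁+a₃≤m = ≤-pred (+-cancelʳ-≤ (m + m) _ _ (begin
      suc (a₁ + a₃) + (m + m)  ≡⟨ sym (+-suc (a₁ + a₃) (m + m)) ⟩
      a₁ + a₃ + p              ≤⟨ h ⟩
      a₂ + a₂                  ≤⟨ +-mono-≤ a₂≤m+M a₂≤m+M ⟩
      m + M + (m + M)          ≡⟨ collect m M ⟩
      M + M + (m + m)          ≤⟨ +-monoˡ-≤ (m + m) 2M≤1+m ⟩
      suc m + (m + m)          ∎))
  ... | b₁ , refl , h₁ | b₃ , refl , h₃ =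
    <⇒≱ c₂<p (≤-trans (m≤n+m p (b₁ + b₃)) (congruent-gap
      (congruent-halve m (b₁ + b₃) c₂ (subst (λ n → p ∣ ∣ n - c₂ + c₂ ∣) (halves b₁ b₃) p∣))
      -- The cut conditions of the two end terms add up to meet the lower end of the interval in the
      -- middle column.
      (+-cancelʳ-< (M + M) _ _ (begin-strict
        b₁ + b₃ + (M + M)        ≡⟨ +-interchange b₁ b₃ M M ⟩
        (b₁ + M) + (b₃ + M)      ≤⟨ +-mono-≤ h₁ h₃ ⟩
        (m + a₁) + (m + a₃)      ≡⟨ regroup m a₁ a₃ ⟩
        a₁ + a₃ + (m + m)        <⟨ +-monoʳ-< (a₁ + a₃) (n<1+n (m + m)) ⟩
        a₁ + a₃ + p              ≤⟨ h ⟩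
        a₂ + a₂                  ≤⟨ 2a₂≤c₂+2M ⟩
        c₂ + (M + M)             ∎))))
    where
    open ≤-Reasoning
    regroup : ∀ m a b → (m + a) + (m + b) ≡ a + b + (m + m)
    regroup = solve-∀

  -- The comparison is lexicographic: a strict gain in the squares of the first coordinates is worth
  -- at least `K`, more than twice `c₂ * c₂`. Without such a gain the first coordinates coincide and
  -- `fibre-rigid` hands over to the second ones.
  f-midconvex : ∀ {a₁ c₁ a₂ c₂ a₃ c₃} → InS a₁ c₁ → InS a₂ c₂ → InS a₃ c₃ →
    p ∣ ∣ a₁ + a₃ - a₂ + a₂ ∣ → p ∣ ∣ c₁ + c₃ - c₂ + c₂ ∣ →
    (f a₂ c₂ + f a₂ c₂ < f a₁ c₁ + f a₃ c₃) ⊎ ((a₁ ≡ a₂ × a₂ ≡ a₃) × (c₁ ≡ c₂ × c₂ ≡ c₃))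
  f-midconvex {a₁} {c₁} {a₂} {c₂} {a₃} {c₃} x y z p∣a p∣c with ≤-<-connex (a₂ + a₂) (a₁ + a₃)
  ... | inj₂ lt = contradiction (congruent-gap p∣a lt) (no-wrap x y z p∣c)
  ... | inj₁ le with square-convex a₁ a₃ a₂ le
  ...   | inj₂ (refl , refl) with square-convex c₁ c₃ c₂ (≤-reflexive (sym (fibre-rigid x y z p∣c)))
  ...     | inj₂ eqs = inj₂ ((refl , refl) , eqs)
  ...     | inj₁ lt = inj₁ (begin-strict
    f a₂ c₂ + f a₂ c₂                                     ≡⟨ +-interchange (K * (a₂ * a₂)) (c₂ * c₂) (K * (a₂ * a₂)) (c₂ * c₂) ⟩
    K * (a₂ * a₂) + K * (a₂ * a₂) + (c₂ * c₂ + c₂ * c₂)   <⟨ +-monoʳ-< (K * (a₂ * a₂) + K * (a₂ * a₂)) lt ⟩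
    K * (a₂ * a₂) + K * (a₂ * a₂) + (c₁ * c₁ + c₃ * c₃)   ≡⟨ +-interchange (K * (a₂ * a₂)) (K * (a₂ * a₂)) (c₁ * c₁) (c₃ * c₃) ⟩
    f a₂ c₁ + f a₂ c₃                                     ∎)
    where
    open ≤-Reasoning
  f-midconvex {a₁} {c₁} {a₂} {c₂} {a₃} {c₃} x y z p∣a p∣c | inj₁ le | inj₁ lt = inj₁ (begin-strict
    f a₂ c₂ + f a₂ c₂                              ≡⟨ expand K (a₂ * a₂) (c₂ * c₂) ⟩
    K * (a₂ * a₂ + a₂ * a₂) + 2 * (c₂ * c₂)        <⟨ +-monoʳ-< (K * (a₂ * a₂ + a₂ * a₂)) (*-monoʳ-< 2 (*-mono-< (snd<p y) (snd<p y))) ⟩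
    K * (a₂ * a₂ + a₂ * a₂) + K                    ≡⟨ sym (trans (*-suc K (a₂ * a₂ + a₂ * a₂)) (+-comm K _)) ⟩
    K * suc (a₂ * a₂ + a₂ * a₂)                    ≤⟨ *-monoʳ-≤ K lt ⟩
    K * (a₁ * a₁ + a₃ * a₃)                        ≤⟨ m≤m+n _ (c₁ * c₁ + c₃ * c₃) ⟩
    K * (a₁ * a₁ + a₃ * a₃) + (c₁ * c₁ + c₃ * c₃)  ≡⟨ collect K (a₁ * a₁) (a₃ * a₃) (c₁ * c₁) (c₃ * c₃) ⟩
    f a₁ c₁ + f a₃ c₃                              ∎)
    where
    open ≤-Reasoning
    expand : ∀ k a c → (k * a + c) + (k * a + c) ≡ k * (a + a) + 2 * c
    expand = solve-∀
    collect : ∀ k a a' c c' → k * (a + a') + (c + c') ≡ (k * a + c) + (k * a' + c')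
    collect = solve-∀

-- Pigeonhole principle and enumeration by rows.

length-filter-∁ : ∀ {A : Set} {P : Pred A 0ℓ} (P? : Decidable P) (xs : List A) →
  length xs ≡ length (filter P? xs) + length (filter (∁? P?) xs)
length-filter-∁ P? []       = refl
length-filter-∁ P? (x ∷ xs) with ih ← length-filter-∁ P? xs | does (P? x)
... | true  = cong suc ih
... | false = trans (cong suc ih) (sym (+-suc _ _))

-- Induction on the number of classes: split off the top class, and keep the larger of it and the
-- class found in the rest.
pigeonhole : ∀ {A : Set} (w : A → ℕ) B (xs : List A) → (∀ {x} → x ∈ xs → w x < B) →
  ∃ λ v → length xs ≤ B * length (filter (λ x → w x ≟ v) xs)
pigeonhole w zero    []       w<B = 0 , z≤n
pigeonhole w zero    (x ∷ xs) w<B = contradiction (w<B (here refl)) n≮0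
pigeonhole w (suc B) xs       w<1+B = choose (≤-total (count B) (count v))
  where
  open ≤-Reasoning
  count : ℕ → ℕ
  count u = length (filter (λ x → w x ≟ u) xs)
  rest = filter (∁? (λ x → w x ≟ B)) xs
  rest<B : ∀ {x} → x ∈ rest → w x < B
  rest<B x∈ with x∈xs , w≢B ← ∈-filter⁻ (∁? (λ x → w x ≟ B)) {xs = xs} x∈ = ≤∧≢⇒< (≤-pred (w<1+B x∈xs)) w≢B
  v = proj₁ (pigeonhole w B rest rest<B)
  rest≤ : length rest ≤ B * count v
  rest≤ = ≤-trans (proj₂ (pigeonhole w B rest rest<B)) (*-monoʳ-≤ B
    (length-mono-≤ (filter⁺ (λ x → w x ≟ v) (λ x → w x ≟ v) (λ { refl → id }) (filter-⊆ (∁? (λ x → w x ≟ B)) xs))))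
  bound : ∀ u → count B ≤ u → count v ≤ u → length xs ≤ suc B * u
  bound u B≤ v≤ = begin
    length xs               ≡⟨ length-filter-∁ (λ x → w x ≟ B) xs ⟩
    count B + length rest   ≤⟨ +-mono-≤ B≤ (≤-trans rest≤ (*-monoʳ-≤ B v≤)) ⟩
    u + B * u               ∎
  choose : count B ≤ count v ⊎ count v ≤ count B → ∃ λ u → length xs ≤ suc B * count u
  choose (inj₁ B≤v) = v , bound (count v) B≤v ≤-refl
  choose (inj₂ v≤B) = B , bound (count B) ≤-refl v≤B

length-cartesianProductWith : ∀ {A B C : Set} (f : A → B → C) xs ys →
  length (cartesianProductWith f xs ys) ≡ length xs * length ys
length-cartesianProductWith f []       ys = refl
length-cartesianProductWith f (x ∷ xs) ys = trans (length-++ (map (f x) ys))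
  (cong₂ _+_ (length-map (f x) ys) (length-cartesianProductWith f xs ys))

module _ {X : Set} {n} (ℓ : Fin n → ℕ) (cell : ∀ i → Fin (ℓ i) → X) where

  rows : List X
  rows = concat (tabulate λ i → tabulate (cell i))

  ∈-rows⁻ : ∀ {x} → x ∈ rows → ∃ λ i → ∃ λ j → x ≡ cell i j
  ∈-rows⁻ x∈ with ∈-concat⁻′ _ x∈
  ... | _ , x∈row , row∈ with ∈-tabulate⁻ {f = λ i → tabulate (cell i)} row∈
  ... | i , refl with ∈-tabulate⁻ x∈row
  ... | j , eq = i , j , eq

  rows-unique : (∀ {i i′ j j′} → cell i j ≡ cell i′ j′ → i ≡ i′) →
    (∀ {i j j′} → cell i j ≡ cell i j′ → j ≡ j′) → Unique rows
  rows-unique injᵢ injⱼ = Uniqueₚ.concat⁺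
    (Allₚ.tabulate⁺ λ i → Uniqueₚ.tabulate⁺ injⱼ)
    (AllPairsₚ.tabulate⁺ λ i≢i′ (x∈ , x∈′) →
      i≢i′ (injᵢ (trans (sym (proj₂ (∈-tabulate⁻ x∈))) (proj₂ (∈-tabulate⁻ x∈′)))))

length-rows : ∀ {X : Set} {n} (ℓ : Fin n → ℕ) (cell : ∀ i → Fin (ℓ i) → X) →
  length (rows ℓ cell) ≡ sum (tabulate ℓ)
length-rows {n = zero}  ℓ cell = refl
length-rows {n = suc n} ℓ cell = trans (length-++ (tabulate (cell zero)))
  (cong₂ _+_ (length-tabulate (cell zero)) (length-rows (ℓ ∘ suc) (cell ∘ suc)))

-- Products of a planar set and their weight classes.

∣⊖∣≡∣-∣ : ∀ x y → ℤ.∣ x ℤ.⊖ y ∣ ≡ ∣ x - y ∣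
∣⊖∣≡∣-∣ x y with ≤-total x y
... | inj₁ x≤y = trans (ℤₚ.∣⊖∣-≤ x≤y) (sym (m≤n⇒∣m-n∣≡n∸m x≤y))
... | inj₂ y≤x = trans (ℤₚ.∣m⊖n∣≡∣n⊖m∣ x y) (trans (ℤₚ.∣⊖∣-≤ y≤x)
  (sym (trans (∣-∣-comm x y) (m≤n⇒∣m-n∣≡n∸m y≤x))))

-- Integer divisibility unfolds to divisibility of absolute values, so the rest of the argument can
-- stay in `ℕ`.
IsAP⇒congruent : ∀ {p n x y z} → IsAP p n x y z → ∀ i →
  p ∣ ∣ toℕ (lookup x i) + toℕ (lookup z i) - toℕ (lookup y i) + toℕ (lookup y i) ∣
IsAP⇒congruent {p} {n} {x} {y} {z} ap i = subst (p ∣_)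
  (trans (cong ℤ.∣_∣ (ℤₚ.m-n≡m⊖n X Y)) (∣⊖∣≡∣-∣ X Y)) (ap i)
  where
  X = toℕ (lookup x i) + toℕ (lookup z i)
  Y = toℕ (lookup y i) + toℕ (lookup y i)

Coord : ℕ → Set
Coord k = Fin (suc k) × Fin (suc k)

MidConvex : ∀ {k} → List (Coord k) → (Coord k → ℕ) → Set
MidConvex {k} S g = ∀ {x y z} → x ∈ S → y ∈ S → z ∈ S →
  suc k ∣ ∣ toℕ (proj₁ x) + toℕ (proj₁ z) - toℕ (proj₁ y) + toℕ (proj₁ y) ∣ →
  suc k ∣ ∣ toℕ (proj₂ x) + toℕ (proj₂ z) - toℕ (proj₂ y) + toℕ (proj₂ y) ∣ →
  (g y + g y < g x + g z) ⊎ (x ≡ y × y ≡ z)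

module Words {k} (S : List (Coord k)) (g : Coord k → ℕ) where

  prepend : ∀ {n} → Coord k → 𝔽^ (suc k) n → 𝔽^ (suc k) (2 + n)
  prepend (a , c) v = a ∷ c ∷ v

  -- Coordinates are taken in pairs. For odd `n` the last one is fixed at `zero`, at the cost of a
  -- single factor `suc k` in the count.
  words : ∀ n → List (𝔽^ (suc k) n)
  words zero          = [] ∷ []
  words (suc zero)    = (zero ∷ []) ∷ []
  words (suc (suc n)) = cartesianProductWith prepend S (words n)

  weight : ∀ {n} → 𝔽^ (suc k) n → ℕ
  weight []          = 0
  weight (_ ∷ [])    = 0
  weight (a ∷ c ∷ v) = g (a , c) + weight v

  words-unique : Unique S → ∀ n → Unique (words n)
  words-unique S! zero          = [] ∷ []
  words-unique S! (suc zero)    = [] ∷ []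
  words-unique S! (suc (suc n)) =
    Uniqueₚ.cartesianProductWith⁺ prepend (λ { refl → refl , refl }) S! (words-unique S! n)

  weight≤ : ∀ {F} → (∀ {x} → x ∈ S → g x ≤ F) → ∀ n {v} → v ∈ words n → weight v ≤ n * F
  weight≤ g≤F zero          (here refl) = z≤n
  weight≤ g≤F (suc zero)    (here refl) = z≤n
  weight≤ {F} g≤F (suc (suc n)) v∈ with ∈-cartesianProductWith⁻ prepend S (words n) v∈
  ... | _ , _ , s∈ , u∈ , refl = +-mono-≤ (g≤F s∈) (≤-trans (weight≤ g≤F n u∈) (m≤n+m (n * F) F))

  -- Convexity adds up over the pairs: a pair either is constant and contributes equality, or makes
  -- the total strict.
  weight-midconvex : MidConvex S g → ∀ n {x y z} → x ∈ words n → y ∈ words n → z ∈ words n →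
    IsAP (suc k) n x y z → (weight y + weight y < weight x + weight z) ⊎ (x ≡ y × y ≡ z)
  weight-midconvex conv zero       (here refl) (here refl) (here refl) _ = inj₂ (refl , refl)
  weight-midconvex conv (suc zero) (here refl) (here refl) (here refl) _ = inj₂ (refl , refl)
  weight-midconvex conv (suc (suc n)) {x} {y} {z} x∈ y∈ z∈ ap
    with ∈-cartesianProductWith⁻ prepend S (words n) x∈
       | ∈-cartesianProductWith⁻ prepend S (words n) y∈
       | ∈-cartesianProductWith⁻ prepend S (words n) z∈
  ... | sx , ux , sx∈ , ux∈ , refl | sy , uy , sy∈ , uy∈ , refl | sz , uz , sz∈ , uz∈ , refl
    with conv sx∈ sy∈ sz∈ (IsAP⇒congruent {x = x} {y} {z} ap zero) (IsAP⇒congruent {x = x} {y} {z} ap (suc zero))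
       | weight-midconvex conv n ux∈ uy∈ uz∈ (λ i → ap (suc (suc i)))
  ... | inj₂ (refl , refl) | inj₂ (refl , refl) = inj₂ (refl , refl)
  ... | inj₂ (refl , refl) | inj₁ lt = inj₁ (subst₂ _<_ (+-interchange (g sx) (g sx) (weight uy) (weight uy))
          (+-interchange (g sx) (g sx) (weight ux) (weight uz)) (+-monoʳ-< (g sx + g sx) lt))
  ... | inj₁ lt | r = inj₁ (subst₂ _<_ (+-interchange (g sy) (g sy) (weight uy) (weight uy))
          (+-interchange (g sx) (g sz) (weight ux) (weight uz)) (+-mono-<-≤ lt (weaken r)))
    where
    weaken : (weight uy + weight uy < weight ux + weight uz) ⊎ (ux ≡ uy × uy ≡ uz) →
      weight uy + weight uy ≤ weight ux + weight uz
    weaken (inj₁ lt)            = <⇒≤ lt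
    weaken (inj₂ (refl , refl)) = ≤-refl

  level : ∀ n → ℕ → List (𝔽^ (suc k) n)
  level n v = filter (λ x → weight x ≟ v) (words n)

  -- Within one level the strict inequality would read `v + v < v + v`.
  level-free : MidConvex S g → ∀ n v → ThreeAPFree (suc k) n (level n v)
  level-free conv n v x y z x∈ y∈ z∈ x≢y _ _ ap
    with ∈-filter⁻ (λ x → weight x ≟ v) {xs = words n} x∈
       | ∈-filter⁻ (λ x → weight x ≟ v) {xs = words n} y∈
       | ∈-filter⁻ (λ x → weight x ≟ v) {xs = words n} z∈
  ... | x∈w , wx | y∈w , wy | z∈w , wz with weight-midconvex conv n x∈w y∈w z∈w ap
  ... | inj₂ (x≡y , _) = x≢y x≡y
  ... | inj₁ lt = <-irrefl (trans (cong₂ _+_ wy wy) (sym (cong₂ _+_ wx wz))) lt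

-- Listing the points of the region and counting them.

sum-odds : ∀ M → sum (tabulate {n = M} (λ s → (M ∸ toℕ s) + (M ∸ toℕ s) ∸ 1)) ≡ M * M
sum-odds zero    = refl
sum-odds (suc M) = trans (cong (M + suc M +_) (sum-odds M)) (square M)
  where
  square : ∀ M → M + suc M + M * M ≡ suc M * suc M
  square = solve-∀

-- The shortfalls are at most `M`, `M - 1`, and so on down to zero, hence at most a triangular
-- number in total. Doubling avoids the division by 2.
sum-deficient : ∀ H n M (ℓ : Fin n → ℕ) → (∀ i → H ≤ ℓ i + (M ∸ toℕ i)) →
  2 * (n * H) ≤ 2 * sum (tabulate ℓ) + M * suc M
sum-deficient H zero    M       ℓ H≤ = z≤n
sum-deficient H (suc n) zero    ℓ H≤ = begin
  2 * (H + n * H)                                       ≡⟨ *-distribˡ-+ 2 H (n * H) ⟩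
  2 * H + 2 * (n * H)                                   ≤⟨ +-mono-≤ (*-monoʳ-≤ 2 (H≤ zero)) (sum-deficient H n 0 (ℓ ∘ suc) tail) ⟩
  2 * (ℓ zero + 0) + (2 * sum (tabulate (ℓ ∘ suc)) + 0) ≡⟨ collect (ℓ zero) (sum (tabulate (ℓ ∘ suc))) ⟩
  2 * (ℓ zero + sum (tabulate (ℓ ∘ suc))) + 0           ∎
  where
  open ≤-Reasoning
  tail : ∀ i → H ≤ ℓ (suc i) + (0 ∸ toℕ i)
  tail i = ≤-trans (H≤ (suc i)) (+-monoʳ-≤ (ℓ (suc i)) z≤n)
  collect : ∀ a b → 2 * (a + 0) + (2 * b + 0) ≡ 2 * (a + b) + 0
  collect = solve-∀
sum-deficient H (suc n) (suc M) ℓ H≤ = begin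
  2 * (H + n * H)                                       ≡⟨ *-distribˡ-+ 2 H (n * H) ⟩
  2 * H + 2 * (n * H)                                   ≤⟨ +-mono-≤ (*-monoʳ-≤ 2 (H≤ zero)) (sum-deficient H n M (ℓ ∘ suc) (H≤ ∘ suc)) ⟩
  2 * (ℓ zero + suc M) + (2 * sum (tabulate (ℓ ∘ suc)) + M * suc M) ≡⟨ collect (ℓ zero) (sum (tabulate (ℓ ∘ suc))) M ⟩
  2 * (ℓ zero + sum (tabulate (ℓ ∘ suc))) + suc M * suc (suc M)     ∎
  where
  open ≤-Reasoning
  collect : ∀ a b M → 2 * (a + suc M) + (2 * b + M * suc M) ≡ 2 * (a + b) + suc M * suc (suc M)
  collect = solve-∀

module Points (m M : ℕ) (2M≤1+m : M + M ≤ suc m) where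

  open Region m M 2M≤1+m

  point : ∀ {a c} → InS a c → Coord (m + m)
  point h = fromℕ< (fst<p h) , fromℕ< (snd<p h)

  point-injective : ∀ {a c a′ c′} (h : InS a c) (h′ : InS a′ c′) → point h ≡ point h′ → a ≡ a′ × c ≡ c′
  point-injective h h′ eq with ,-injective eq
  ... | eqᵃ , eqᶜ = fromℕ<-injective _ _ (fst<p h) (fst<p h′) eqᵃ , fromℕ<-injective _ _ (snd<p h) (snd<p h′) eqᶜ

  -- Truncated subtraction leaves the columns from `M` on uncut.
  lowerLength : Fin (suc m) → ℕ
  lowerLength i = suc m ∸ (M ∸ toℕ i)

  -- For `a = suc m + s` the values from `2 * a - 2 * M` to `p - 1` number `2 * (M - s) - 1`.
  upperLength : Fin M → ℕ
  upperLength s = (M ∸ toℕ s) + (M ∸ toℕ s) ∸ 1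

  lowerIn : ∀ i (j : Fin (lowerLength i)) → InS (toℕ i) (toℕ j + toℕ j)
  lowerIn i j = lower (toℕ≤pred[n] i) (≤-pred (≤-trans (toℕ<n j) (m∸n≤m (suc m) η))) (begin
    toℕ j + M             ≤⟨ +-monoʳ-≤ (toℕ j) (≤-trans (m≤n+m∸n M (toℕ i)) (≤-reflexive (+-comm (toℕ i) η))) ⟩
    toℕ j + (η + toℕ i)   ≡⟨ sym (+-assoc (toℕ j) η (toℕ i)) ⟩
    toℕ j + η + toℕ i     ≤⟨ +-monoˡ-≤ (toℕ i) (≤-pred (m≤o∸n⇒m+n≤o (suc (toℕ j)) η≤1+m (toℕ<n j))) ⟩
    m + toℕ i             ∎)
    where
    open ≤-Reasoning
    η = M ∸ toℕ i
    η≤1+m : η ≤ suc m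
    η≤1+m = ≤-trans (m∸n≤m M (toℕ i)) (m≤n⇒m≤1+n M≤m)

  upper-bounds : ∀ s (t : Fin (upperLength s)) →
    2 + toℕ t + (toℕ s + toℕ s) ≤ M + M
  upper-bounds s t = begin
    2 + toℕ t + (toℕ s + toℕ s)  ≡⟨ cong (λ n → suc n + (toℕ s + toℕ s)) (sym (+-comm (toℕ t) 1)) ⟩
    suc (toℕ t) + 1 + (toℕ s + toℕ s)  ≤⟨ +-monoˡ-≤ (toℕ s + toℕ s) (m≤o∸n⇒m+n≤o (suc (toℕ t)) (≤-trans e≥1 (m≤m+n e e)) (toℕ<n t)) ⟩
    e + e + (toℕ s + toℕ s)      ≡⟨ regroup e (toℕ s) ⟩
    (e + toℕ s) + (e + toℕ s)    ≡⟨ cong (λ n → n + n) (m∸n+n≡m (<⇒≤ (toℕ<n s))) ⟩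
    M + M                        ∎
    where
    open ≤-Reasoning
    e = M ∸ toℕ s
    e≥1 : 1 ≤ e
    e≥1 = m<n⇒0<n∸m (toℕ<n s)
    regroup : ∀ e s → e + e + (s + s) ≡ (e + s) + (e + s)
    regroup = solve-∀

  t≤2m : ∀ s (t : Fin (upperLength s)) → toℕ t ≤ m + m
  t≤2m s t = ≤-trans (≤-trans (m≤n+m (toℕ t) 2) (m≤m+n (2 + toℕ t) (toℕ s + toℕ s)))
    (≤-trans (upper-bounds s t) (+-mono-≤ M≤m M≤m))

  -- Values are counted down from `p - 1`, the common top of all new columns.
  upperIn : ∀ s (t : Fin (upperLength s)) → InS (suc m + toℕ s) (m + m ∸ toℕ t)
  upperIn s t = upper (m≤m+n (suc m) (toℕ s)) (+-monoʳ-< m (toℕ<n s)) (s≤s (m∸n≤m (m + m) (toℕ t)))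
    (+-cancelˡ-≤ (toℕ t) _ _ (begin
      toℕ t + (suc m + toℕ s + (suc m + toℕ s))       ≡⟨ regroup (toℕ t) m (toℕ s) ⟩
      m + m + (2 + toℕ t + (toℕ s + toℕ s))           ≤⟨ +-monoʳ-≤ (m + m) (upper-bounds s t) ⟩
      m + m + (M + M)                                 ≡⟨ cong (_+ (M + M)) (sym (m+[n∸m]≡n (t≤2m s t))) ⟩
      toℕ t + (m + m ∸ toℕ t) + (M + M)               ≡⟨ +-assoc (toℕ t) _ (M + M) ⟩
      toℕ t + (m + m ∸ toℕ t + (M + M))               ∎))
    where
    open ≤-Reasoning
    regroup : ∀ t m s → t + (suc m + s + (suc m + s)) ≡ m + m + (2 + t + (s + s))
    regroup = solve-∀

  lowerPoint : ∀ i → Fin (lowerLength i) → Coord (m + m)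
  lowerPoint i j = point (lowerIn i j)

  upperPoint : ∀ s → Fin (upperLength s) → Coord (m + m)
  upperPoint s t = point (upperIn s t)

  lowerPart upperPart S : List (Coord (m + m))
  lowerPart = rows lowerLength lowerPoint
  upperPart = rows upperLength upperPoint
  S = lowerPart ++ upperPart

  double-injective : ∀ {x y} → x + x ≡ y + y → x ≡ y
  double-injective {x} {y} eq = *-cancelˡ-≡ x y 2 (trans (twice x) (trans eq (sym (twice y))))
    where
    twice : ∀ n → 2 * n ≡ n + n
    twice = solve-∀

  S-unique : Unique S
  S-unique = Uniqueₚ.++⁺
    (rows-unique lowerLength lowerPoint
      (λ {i} {i′} {j} {j′} eq → toℕ-injective (proj₁ (point-injective (lowerIn i j) (lowerIn i′ j′) eq)))
      (λ {i} {j} {j′} eq → toℕ-injective (double-injective (proj₂ (point-injective (lowerIn i j) (lowerIn i j′) eq)))))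
    (rows-unique upperLength upperPoint
      (λ {s} {s′} {t} {t′} eq → toℕ-injective (+-cancelˡ-≡ (suc m) _ _ (proj₁ (point-injective (upperIn s t) (upperIn s′ t′) eq))))
      (λ {s} {t} {t′} eq → toℕ-injective (∸-cancelˡ-≡ (t≤2m s t) (t≤2m s t′) (proj₂ (point-injective (upperIn s t) (upperIn s t′) eq)))))
    disjoint
    where
    disjoint : ∀ {x} → ¬ (x ∈ lowerPart × x ∈ upperPart)
    disjoint (x∈ , x∈′) with ∈-rows⁻ lowerLength lowerPoint x∈ | ∈-rows⁻ upperLength upperPoint x∈′
    ... | i , j , refl | s , t , eq =
      <⇒≱ (toℕ<n i) (subst (suc m ≤_) (sym (proj₁ (point-injective (lowerIn i j) (upperIn s t) eq))) (m≤m+n (suc m) (toℕ s)))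

  point-in : ∀ {a c} (h : InS a c) → InS (toℕ (proj₁ (point h))) (toℕ (proj₂ (point h)))
  point-in h = subst₂ InS (sym (toℕ-fromℕ< (fst<p h))) (sym (toℕ-fromℕ< (snd<p h))) h

  S-in : ∀ {x} → x ∈ S → InS (toℕ (proj₁ x)) (toℕ (proj₂ x))
  S-in x∈ with ∈-++⁻ lowerPart x∈
  ... | inj₁ x∈l with ∈-rows⁻ lowerLength lowerPoint x∈l
  ...   | i , j , refl = point-in (lowerIn i j)
  S-in x∈ | inj₂ x∈u with ∈-rows⁻ upperLength upperPoint x∈u
  ...   | s , t , refl = point-in (upperIn s t)

  g : Coord (m + m) → ℕ
  g (a , c) = f (toℕ a) (toℕ c)

  F : ℕ
  F = K * (p * p) + p * p

  g≤F : ∀ x → g x ≤ F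
  g≤F (a , c) = +-mono-≤ (*-monoʳ-≤ K (*-mono-≤ (<⇒≤ (toℕ<n a)) (<⇒≤ (toℕ<n a)))) (*-mono-≤ (<⇒≤ (toℕ<n c)) (<⇒≤ (toℕ<n c)))

  g-midconvex : MidConvex S g
  g-midconvex x∈ y∈ z∈ p∣a p∣c with f-midconvex (S-in x∈) (S-in y∈) (S-in z∈) p∣a p∣c
  ... | inj₁ lt = inj₁ lt
  ... | inj₂ ((a₁≡a₂ , a₂≡a₃) , (c₁≡c₂ , c₂≡c₃)) = inj₂
    ( cong₂ _,_ (toℕ-injective a₁≡a₂) (toℕ-injective c₁≡c₂)
    , cong₂ _,_ (toℕ-injective a₂≡a₃) (toℕ-injective c₂≡c₃) )

  -- The full square, plus `M * M` points in the new columns, minus the triangle of at most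
  -- `M * suc M / 2` points; doubled and free of subtraction.
  S-size : 2 * (suc m * suc m) + 2 * (M * M) ≤ 2 * length S + M * suc M
  S-size = begin
    2 * (suc m * suc m) + 2 * (M * M)                       ≤⟨ +-monoˡ-≤ _ (sum-deficient (suc m) (suc m) M lowerLength row) ⟩
    2 * Σℓ + M * suc M + 2 * (M * M)                        ≡⟨ regroup Σℓ (M * suc M) (M * M) ⟩
    2 * (Σℓ + M * M) + M * suc M                            ≡⟨ cong (λ n → 2 * n + M * suc M) (sym size) ⟩
    2 * length S + M * suc M                                ∎
    where
    open ≤-Reasoning
    Σℓ = sum (tabulate lowerLength)
    row : ∀ i → suc m ≤ lowerLength i + (M ∸ toℕ i)
    row i = ≤-trans (m≤n+m∸n (suc m) (M ∸ toℕ i)) (≤-reflexive (+-comm (M ∸ toℕ i) (lowerLength i)))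
    size : length S ≡ Σℓ + M * M
    size = trans (length-++ lowerPart) (cong₂ _+_ (length-rows lowerLength lowerPoint)
      (trans (length-rows upperLength upperPoint) (sum-odds M)))
    regroup : ∀ a b c → 2 * a + b + 2 * c ≡ 2 * (a + c) + b
    regroup = solve-∀

-- Exponential growth and the size of the best weight class.

-- This is `1 + k / q ≤ (1 + 1 / q) ^ k` with denominators cleared.
bernoulli : ∀ q k → (q + k) * q ^ k ≤ q * suc q ^ k
bernoulli q zero    = ≤-reflexive (base q)
  where
  base : ∀ q → (q + 0) * 1 ≡ q * 1
  base = solve-∀
bernoulli q (suc k) = begin
  (q + suc k) * (q * q ^ k)         ≤⟨ m≤m+n _ (k * q ^ k) ⟩
  (q + suc k) * (q * q ^ k) + k * q ^ k ≡⟨ regroup q k (q ^ k) ⟩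
  suc q * ((q + k) * q ^ k)         ≤⟨ *-monoʳ-≤ (suc q) (bernoulli q k) ⟩
  suc q * (q * suc q ^ k)           ≡⟨ *-swapˡ (suc q) q (suc q ^ k) ⟩
  q * (suc q * suc q ^ k)           ∎
  where
  open ≤-Reasoning
  regroup : ∀ q k x → (q + suc k) * (q * x) + k * x ≡ suc q * ((q + k) * x)
  regroup = solve-∀

-- Bernoulli's inequality at both q and q + 1 gives quadratic growth of ((q + 2) / q) ^ n.
linear*exponential : ∀ q .{{_ : NonZero q}} C n → q * suc q * C ≤ n → C * suc n * q ^ n ≤ (2 + q) ^ n
linear*exponential q C n N≤n = *-cancelˡ-≤ (q * suc q) {{m*n≢0 q (suc q)}} (begin
  q * suc q * (C * suc n * q ^ n)          ≡⟨ regroup q C n (q ^ n) ⟩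
  q * suc q * C * (suc n * q ^ n)          ≤⟨ *-mono-≤ (≤-trans N≤n (m≤n+m n q)) (*-monoˡ-≤ (q ^ n) (s≤s (m≤n+m n q))) ⟩
  (q + n) * (suc (q + n) * q ^ n)          ≡⟨ *-swapˡ (q + n) (suc (q + n)) (q ^ n) ⟩
  suc (q + n) * ((q + n) * q ^ n)          ≤⟨ *-monoʳ-≤ (suc (q + n)) (bernoulli q n) ⟩
  suc (q + n) * (q * suc q ^ n)            ≡⟨ *-swapˡ (suc (q + n)) q (suc q ^ n) ⟩
  q * (suc (q + n) * suc q ^ n)            ≤⟨ *-monoʳ-≤ q (bernoulli (suc q) n) ⟩
  q * (suc q * suc (suc q) ^ n)            ≡⟨ sym (*-assoc q (suc q) _) ⟩
  q * suc q * (2 + q) ^ n                  ∎)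
  where
  open ≤-Reasoning
  regroup : ∀ q C n x → q * suc q * (C * suc n * x) ≡ q * suc q * C * (suc n * x)
  regroup = solve-∀

-- 9 / 17 is a rational just below √(9 / 32).
words-length : ∀ {k} (S : List (Coord k)) (g : Coord k → ℕ) → 9 * (suc k * suc k) ≤ 32 * length S →
  ∀ n → (9 * suc k) ^ n ≤ suc k * (17 ^ n * length (Words.words S g n))
words-length {k} S g dense = go
  where
  open ≤-Reasoning
  open Words S g
  p = suc k
  expand : ∀ p x → 9 * p * (9 * p * x) ≡ 9 * (9 * (p * p)) * x
  expand = solve-∀
  collect : ∀ p s l y → 289 * s * (p * (y * l)) ≡ p * (17 * (17 * y) * (s * l))
  collect = solve-∀
  go : ∀ n → (9 * p) ^ n ≤ p * (17 ^ n * length (words n))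
  go zero       = s≤s z≤n
  go (suc zero) = ≤-trans (*-monoˡ-≤ 1 (*-monoˡ-≤ p (m≤m+n 9 8))) (≤-reflexive (base p))
    where
    base : ∀ p → 17 * p * 1 ≡ p * 17
    base = solve-∀
  go (suc (suc n)) = begin
    9 * p * (9 * p * (9 * p) ^ n)                              ≡⟨ expand p ((9 * p) ^ n) ⟩
    9 * (9 * (p * p)) * (9 * p) ^ n                            ≤⟨ *-mono-≤ rate (go n) ⟩
    289 * length S * (p * (17 ^ n * length (words n)))         ≡⟨ collect p (length S) (length (words n)) (17 ^ n) ⟩
    p * (17 * (17 * 17 ^ n) * (length S * length (words n)))   ≡⟨ cong (λ l → p * (17 * (17 * 17 ^ n) * l)) (sym (length-cartesianProductWith prepend S (words n))) ⟩
    p * (17 ^ (2 + n) * length (words (2 + n)))                ∎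
    where
    -- That 9/17 is below the square root of 9/32 comes down to 288 < 289.
    rate : 9 * (9 * (p * p)) ≤ 289 * length S
    rate = begin
      9 * (9 * (p * p))        ≤⟨ *-monoʳ-≤ 9 dense ⟩
      9 * (32 * length S)      ≡⟨ sym (*-assoc 9 32 (length S)) ⟩
      288 * length S           ≤⟨ *-monoˡ-≤ (length S) (n≤1+n 288) ⟩
      289 * length S           ∎

^-*-distrib : ∀ n a b → (a * b) ^ n ≡ a ^ n * b ^ n
^-*-distrib zero    a b = refl
^-*-distrib (suc n) a b = trans (cong (a * b *_) (^-*-distrib n a b)) (*-interchange a b (a ^ n) (b ^ n))

LargeAPFree : ℕ → ℕ → Set
LargeAPFree p n = Σ (List (𝔽^ p n)) λ A → Unique A × ThreeAPFree p n A × ((11 * p) ^ n ≤ length A * 21 ^ n)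

lift-midconvex : ∀ {k} (S : List (Coord k)) (g : Coord k → ℕ) F → Unique S → (∀ x → g x ≤ F) → MidConvex S g →
  9 * (suc k * suc k) ≤ 32 * length S →
  ∃ λ N → ∀ n → N ≤ n → LargeAPFree (suc k) n
-- As 187 = 11 * 17 and 189 = 9 * 21, the ratio of 9/17 to 11/21 is 189/187. From this threshold on
-- its `n`-th power exceeds `p * suc F * suc n`, the loss from padding and pigeonhole.
lift-midconvex {k} S g F S! g≤F conv dense = 187 * 188 * (p * suc F) , λ n N≤n →
  let v , W≤ = pigeonhole weight (suc (n * F)) (words n) (λ x∈ → s≤s (weight≤ (λ {x} _ → g≤F x) n x∈))
  in level n v , Uniqueₚ.filter⁺ (λ x → weight x ≟ v) (words-unique S! n) , level-free conv n v , size n N≤n (length (level n v)) W≤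
  where
  open Words S g
  open ≤-Reasoning
  p = suc k
  size : ∀ n → 187 * 188 * (p * suc F) ≤ n → ∀ L → length (words n) ≤ suc (n * F) * L → (11 * p) ^ n ≤ L * 21 ^ n
  size n N≤n L W≤ = *-cancelˡ-≤ (9 ^ n) {{m^n≢0 9 n}} (begin
    9 ^ n * (11 * p) ^ n                          ≡⟨ cong (9 ^ n *_) (^-*-distrib n 11 p) ⟩
    9 ^ n * (11 ^ n * p ^ n)                      ≡⟨ *-swapˡ (9 ^ n) (11 ^ n) (p ^ n) ⟩
    11 ^ n * (9 ^ n * p ^ n)                      ≡⟨ cong (11 ^ n *_) (sym (^-*-distrib n 9 p)) ⟩
    11 ^ n * (9 * p) ^ n                          ≤⟨ *-monoʳ-≤ (11 ^ n) (words-length S g dense n) ⟩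
    11 ^ n * (p * (17 ^ n * length (words n)))    ≤⟨ *-monoʳ-≤ (11 ^ n) (*-monoʳ-≤ p (*-monoʳ-≤ (17 ^ n) W≤′)) ⟩
    11 ^ n * (p * (17 ^ n * (suc F * suc n * L))) ≡⟨ regroup (11 ^ n) p (17 ^ n) (suc F) (suc n) L ⟩
    p * suc F * suc n * (11 ^ n * 17 ^ n) * L     ≡⟨ cong (λ x → p * suc F * suc n * x * L) (sym (^-*-distrib n 11 17)) ⟩
    p * suc F * suc n * 187 ^ n * L               ≤⟨ *-monoˡ-≤ L (linear*exponential 187 (p * suc F) n N≤n) ⟩
    189 ^ n * L                                   ≡⟨ cong (_* L) (^-*-distrib n 9 21) ⟩
    9 ^ n * 21 ^ n * L                            ≡⟨ *-assoc (9 ^ n) (21 ^ n) L ⟩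
    9 ^ n * (21 ^ n * L)                          ≡⟨ cong (9 ^ n *_) (*-comm (21 ^ n) L) ⟩
    9 ^ n * (L * 21 ^ n)                          ∎)
    where
    regroup : ∀ a p b F n L → a * (p * (b * (F * n * L))) ≡ p * F * n * (a * b) * L
    regroup = solve-∀
    expand : ∀ n F → suc (n * F) + (n + F) ≡ suc F * suc n
    expand = solve-∀
    W≤′ : length (words n) ≤ suc F * suc n * L
    W≤′ = ≤-trans W≤ (*-monoˡ-≤ L (≤-trans (m≤m+n (suc (n * F)) (n + F)) (≤-reflexive (expand n F))))

-- The individual primes.

-- The numerical hypothesis is what `S-size`, scaled by 16, needs in order to give density 9/32.
odd-case : ∀ m M → M + M ≤ suc m →
  9 * (suc (m + m) * suc (m + m)) + 16 * (M * suc M) ≤ 32 * (suc m * suc m) + 32 * (M * M) →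
  ∃ λ N → ∀ n → N ≤ n → LargeAPFree (suc (m + m)) n
odd-case m M 2M≤1+m bound = lift-midconvex S g F S-unique g≤F g-midconvex
  (+-cancelʳ-≤ (16 * (M * suc M)) _ _ (begin
    9 * (suc (m + m) * suc (m + m)) + 16 * (M * suc M)   ≤⟨ bound ⟩
    32 * (suc m * suc m) + 32 * (M * M)                  ≡⟨ scale (suc m * suc m) (M * M) ⟩
    16 * (2 * (suc m * suc m) + 2 * (M * M))             ≤⟨ *-monoʳ-≤ 16 S-size ⟩
    16 * (2 * length S + M * suc M)                      ≡⟨ unscale (length S) (M * suc M) ⟩
    32 * length S + 16 * (M * suc M)                     ∎))
  where
  open Points m M 2M≤1+m
  open ≤-Reasoning
  scale : ∀ a b → 32 * a + 32 * b ≡ 16 * (2 * a + 2 * b)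
  scale = solve-∀
  unscale : ∀ a b → 16 * (2 * a + b) ≡ 32 * a + 16 * b
  unscale = solve-∀

binary-words : ∀ n → List (𝔽^ 2 n)
binary-words zero    = [] ∷ []
binary-words (suc n) = cartesianProductWith _∷_ (allFin 2) (binary-words n)

binary-words-unique : ∀ n → Unique (binary-words n)
binary-words-unique zero    = [] ∷ []
binary-words-unique (suc n) =
  Uniqueₚ.cartesianProductWith⁺ _∷_ (λ { refl → refl , refl }) (Uniqueₚ.allFin⁺ 2) (binary-words-unique n)

binary-words-length : ∀ n → length (binary-words n) ≡ 2 ^ n
binary-words-length zero    = refl
binary-words-length (suc n) = trans (length-cartesianProductWith _∷_ (allFin 2) (binary-words n))
  (cong (2 *_) (binary-words-length n))

-- Doubling vanishes modulo 2, so the ends agree in every coordinate; the eight triples of bits are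
-- checked by decision.
binary-AP : ∀ n (x y z : 𝔽^ 2 n) → IsAP 2 n x y z → x ≡ z
binary-AP zero    []      []      []      ap = refl
binary-AP (suc n) (a ∷ x) (b ∷ y) (c ∷ z) ap = cong₂ _∷_
  (bits a b c (IsAP⇒congruent {x = a ∷ x} {b ∷ y} {c ∷ z} ap zero)) (binary-AP n x y z (ap ∘ suc))
  where
  bits : ∀ (a b c : Fin 2) → 2 ∣ ∣ toℕ a + toℕ c - toℕ b + toℕ b ∣ → a ≡ c
  bits = from-yes (all? {n = 2} λ a → all? {n = 2} λ b → all? {n = 2} λ c →
    (2 ∣? ∣ toℕ a + toℕ c - toℕ b + toℕ b ∣) →-dec (a ≟ᶠ c))

binary-case : ∀ n → LargeAPFree 2 n
binary-case n = binary-words n , binary-words-unique n ,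
  (λ x y z _ _ _ _ _ x≢z ap → x≢z (binary-AP n x y z ap)) , (begin
    22 ^ n                            ≤⟨ ^-monoˡ-≤ n (m≤m+n 22 20) ⟩
    42 ^ n                            ≡⟨ ^-*-distrib n 2 21 ⟩
    2 ^ n * 21 ^ n                    ≡⟨ cong (_* 21 ^ n) (sym (binary-words-length n)) ⟩
    length (binary-words n) * 21 ^ n  ∎)
  where open ≤-Reasoning

1-mod-4-case : ∀ q → ∃ λ N → ∀ n → N ≤ n → LargeAPFree (1 + q * 4) n
1-mod-4-case q = subst (λ p → ∃ λ N → ∀ n → N ≤ n → LargeAPFree p n) (value q)
  -- `M = q` is the largest choice allowed for `m = q + q`. The quadratic terms of the bound cancel
  -- exactly, and `40 * q + 23` is the surplus.
  (odd-case (q + q) q (n≤1+n (q + q)) (≤-trans (m≤m+n _ (40 * q + 23)) (≤-reflexive (bound q))))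
  where
  value : ∀ q → suc (q + q + (q + q)) ≡ 1 + q * 4
  value = solve-∀
  bound : ∀ q → 9 * (suc (q + q + (q + q)) * suc (q + q + (q + q))) + 16 * (q * suc q) + (40 * q + 23)
    ≡ 32 * (suc (q + q) * suc (q + q)) + 32 * (q * q)
  bound = solve-∀

3-mod-4-case : ∀ q → ∃ λ N → ∀ n → N ≤ n → LargeAPFree (3 + q * 4) n
3-mod-4-case q = subst (λ p → ∃ λ N → ∀ n → N ≤ n → LargeAPFree p n) (value q)
  -- Again `M` is as large as allowed, here with `M + M` equal to `suc m`.
  (odd-case (suc (q + q)) (suc q) (≤-reflexive (cong suc (+-suc q q)))
    (≤-trans (m≤m+n _ (56 * q + 47)) (≤-reflexive (bound q))))
  where
  value : ∀ q → suc (suc (q + q) + suc (q + q)) ≡ 3 + q * 4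
  value = solve-∀
  bound : ∀ q → 9 * (suc (suc (q + q) + suc (q + q)) * suc (suc (q + q) + suc (q + q))) + 16 * (suc q * suc (suc q)) + (56 * q + 47)
    ≡ 32 * (suc (suc (q + q)) * suc (suc (q + q))) + 32 * (suc q * suc q)
  bound = solve-∀

prime-case : ∀ p → Prime p → ∃ λ N → ∀ n → N ≤ n → LargeAPFree p n
prime-case p p-prime = by-residue (p % 4) (m%n<n p 4) (m≡m%n+[m/n]*n p 4)
  where
  even : 2 ∣ p → ∃ λ N → ∀ n → N ≤ n → LargeAPFree p n
  even 2∣p with prime⇒irreducible p-prime 2∣p
  ... | inj₂ refl = 0 , λ n _ → binary-case n
  2∣q*4 : 2 ∣ (p / 4) * 4
  2∣q*4 = ∣n⇒∣m*n (p / 4) (divides 2 refl)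
  by-residue : ∀ r → r < 4 → p ≡ r + (p / 4) * 4 → ∃ λ N → ∀ n → N ≤ n → LargeAPFree p n
  by-residue 0 _ eq = even (subst (2 ∣_) (sym eq) 2∣q*4)
  by-residue 1 _ eq = subst (λ p → ∃ λ N → ∀ n → N ≤ n → LargeAPFree p n) (sym eq) (1-mod-4-case (p / 4))
  by-residue 2 _ eq = even (subst (2 ∣_) (sym eq) (∣m∣n⇒∣m+n (divides 1 refl) 2∣q*4))
  by-residue 3 _ eq = subst (λ p → ∃ λ N → ∀ n → N ≤ n → LargeAPFree p n) (sym eq) (3-mod-4-case (p / 4))
  by-residue (suc (suc (suc (suc r)))) r<4 _ = contradiction r<4 (≤⇒≯ (m≤m+n 4 r))

theorem1p2 : Σ ℕ λ a → Σ ℕ λ b → (0 < b) × (b < 2 * a) ×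
    (∀ (p : ℕ) → Prime p → Σ ℕ λ N → ∀ (n : ℕ) → 1 ≤ n → N ≤ n →
    Σ (List (𝔽^ p n)) λ A → Unique A × ThreeAPFree p n A ×
    ((a * p) ^ n ≤ length A * b ^ n))
-- The constant is 11/21; it exceeds 1/2 because 21 < 22.
theorem1p2 = 11 , 21 , s≤s z≤n , ≤-refl , λ p p-prime →
  let N , large = prime-case p p-prime in N , λ n _ N≤n → large n N≤n
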